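{- Let $n \geq 1$ and $0 \leq m \leq n$ be integers, and let $\mathbf{t} = (t_1, t_2, \ldots, t_m) \in [n]^m$ be an increasing list (i.e. $t_1 < t_2 < \cdots < t_m$). Let $\mathbf{u} = (u_1, u_2, \ldots, u_{n-m})$ be the increasing rearrangement of $[n] \setminus \{t_1, \ldots, t_m\}$, and let $\mathbf{x} = (u_1, u_2 - u_1, u_3 - u_2, \ldots, u_{n-m} - u_{n-m-1})$. Then the set of parking completions of length $n$ for $\mathbf{t}$ is exactly the set of $\mathbf{x}$-parking functions of length $n-m$; that is, $\operatorname{PC}_n(\mathbf{t}) = \operatorname{PF}_{n-m}(\mathbf{x})$.
   Context: Write $[n] = \{1, 2, \ldots, n\}$ and $\mathbb{N} = \{1, 2, 3, \ldots\}$. Parking functions: on a one-way street there are $n$ spots numbered $1, \ldots, n$ in order. Given a preference list $\mathbf{a} = (a_1, \ldots, a_n) \in [n]^n$, cars $1, 2, \ldots, n$ enter in this order; car $i$ parks in the first available spot numbered at least $a_i$, if one exists. The list $\mathbf{a}$ is a parking function of length $n$ if all cars can park. Equivalently (a standard fact), the weakly increasing rearrangement $\mathbf{a}^\uparrow$ of $\mathbf{a}$ satisfies $a_i^\uparrow \leq i$ for all $i \in [n]$. Parking completions: for a fixed increasing list $\mathbf{t} = (t_1, \ldots, t_m) \in [n]^m$ (spots already taken, so the $t_j$ are distinct), a sequence $\mathbf{c} = (c_1, \ldots, c_{n-m}) \in [n]^{n-m}$ is a parking completion for $\mathbf{t}$ if the concatenation $(t_1, \ldots, t_m, c_1, \ldots,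 c_{n-m})$ is a parking function of length $n$. The set of all parking completions for $\mathbf{t}$ (called "of length $n$" because the street has $n$ spots) is denoted $\operatorname{PC}_n(\mathbf{t})$. $\mathbf{x}$-parking functions: for $\mathbf{x} = (x_1, \ldots, x_N) \in \mathbb{N}^N$, an $\mathbf{x}$-parking function (of length $N$) is a sequence $\mathbf{a} \in \mathbb{N}^N$ whose weakly increasing rearrangement $\mathbf{a}^\uparrow$ satisfies $a_i^\uparrow \leq x_1 + x_2 + \cdots + x_i$ for all $i \in [N]$. The set of these is denoted $\operatorname{PF}_N(\mathbf{x})$. -}

module Defs where

open import Level using (0ℓ)
open import Data.Nat using (ℕ; zero; suc; _+_; _∸_; _≤_; _<_)
open import Data.Nat.Properties using (m+[n∸m]≡n; m<n⇒0<n∸m)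
open import Data.Fin using (Fin; zero; suc)
open import Data.List using (List; []; _∷_)
import Data.List.Membership.Propositional as List
open import Data.List.Relation.Binary.Permutation.Propositional using (_↭_)
open import Data.Product using (_×_; ∃-syntax; proj₁)
open import Data.Vec using (Vec; []; _∷_; _++_; cast; lookup; toList)
open import Data.Vec.Membership.Propositional using (_∈_; _∉_)
open import Data.Vec.Relation.Unary.All using (All; []; _∷_)
open import Data.Vec.Relation.Unary.Any using (here)
open import Data.Vec.Relation.Unary.Linked using (Linked; _∷_)
open import Function.Bundles using (_⇔_; Equivalence)
open import Relation.Binary.PropositionalEquality using (refl)
open import Relation.Unary using (Pred)

infix 4 _∈[_]

-- [n] = {1, …, n}; spots and preferences are 1-based naturals throughout.
_∈[_] : ℕ → ℕ → Set
i ∈[ n ] = 1 ≤ i × i ≤ n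

Increasing : ∀ {k} → Pred (Vec ℕ k) 0ℓ
Increasing = Linked _<_

WeaklyIncreasing : ∀ {k} → Pred (Vec ℕ k) 0ℓ
WeaklyIncreasing = Linked _≤_

-- On a street with spots 1, …, n of which those in occ are taken, a car
-- preferring a parks in s: s is the first available spot numbered at least a.
record ParksIn (n : ℕ) (occ : List ℕ) (a s : ℕ) : Set where
  field
    spot      : s ∈[ n ]
    reachable : a ≤ s
    available : s List.∉ occ
    first     : ∀ j → j ∈[ n ] → a ≤ j → j < s → j List.∈ occ

-- Starting with the spots in occ taken, the cars park successfully in order.
data AllPark (n : ℕ) : (occ : List ℕ) → ∀ {k} → Vec ℕ k → Set where
  done : ∀ {occ} → AllPark n occ []
  park : ∀ {occ k a} {as : Vec ℕ k} s →
         ParksIn n occ a s → AllPark n (s ∷ occ) as → AllPark n occ (a ∷ as)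

IsParkingFunction : ∀ {n} → Pred (Vec ℕ n) 0ℓ
IsParkingFunction {n} a = All (_∈[ n ]) a × AllPark n [] a

-- The cast only identifies the length m + (n ∸ m) of the concatenation with n.
PC : ∀ n {m} → m ≤ n → Vec ℕ m → Pred (Vec ℕ (n ∸ m)) 0ℓ
PC n m≤n t c =
  All (_∈[ n ]) c × IsParkingFunction (cast (m+[n∸m]≡n m≤n) (t ++ c))

Positive : ∀ {k} → Pred (Vec ℕ k) 0ℓ
Positive = All (1 ≤_)

-- partialSum x i = x₁ + ⋯ + xᵢ, where the index i : Fin N counts from zero
-- and the sum includes the entry at i.
partialSum : ∀ {N} → Vec ℕ N → Fin N → ℕ
partialSum (x ∷ xs) zero    = x
partialSum (x ∷ xs) (suc i) = x + partialSum xs i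

-- Here b is the weakly increasing rearrangement of a.  The positivity argument
-- restricts x to vectors of positive integers.
PF : ∀ {N} (x : Vec ℕ N) → Positive x → Pred (Vec ℕ N) 0ℓ
PF {N} x _ a =
  Positive a ×
  ∃[ b ] (toList b ↭ toList a × WeaklyIncreasing {N} b ×
          (∀ i → lookup b i ≤ partialSum x i))

-- u is the increasing rearrangement of [n] ∖ {t₁, …, tₘ}.
record IsComplement (n : ℕ) {m k : ℕ} (t : Vec ℕ m) (u : Vec ℕ k) : Set where
  field
    increasing : Increasing u
    members    : ∀ i → i ∈ u ⇔ (i ∈[ n ] × i ∉ t)

-- gapsFrom p u = (u₁ − p, u₂ − u₁, …); truncated subtraction is harmless since
-- it is only used with p < u₁ < u₂ < ⋯.
gapsFrom : ∀ {k} → ℕ → Vec ℕ k → Vec ℕ k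
gapsFrom p []       = []
gapsFrom p (u ∷ us) = u ∸ p ∷ gapsFrom u us

-- (u₁, u₂ − u₁, …, u_k − u_{k−1})
gaps : ∀ {k} → Vec ℕ k → Vec ℕ k
gaps = gapsFrom 0

gapsFrom-positive : ∀ {k p} {u : Vec ℕ k} →
                    Increasing (p ∷ u) → Positive (gapsFrom p u)
gapsFrom-positive {u = []}    _           = []
gapsFrom-positive {u = _ ∷ _} (p<u ∷ inc) =
  m<n⇒0<n∸m p<u ∷ gapsFrom-positive inc

gaps-positive : ∀ {n m k} {t : Vec ℕ m} {u : Vec ℕ k} →
                IsComplement n t u → Positive (gaps u)
gaps-positive {u = []}    _ = []
gaps-positive {u = v ∷ _} C = gapsFrom-positive (1≤v ∷ increasing)
  where
  open IsComplement C
  1≤v : 1 ≤ v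
  1≤v = proj₁ (proj₁ (Equivalence.to (members v) (here refl)))

-- Both conditions say that c is pointwise dominated by some rearrangement of u.
-- If all cars park, the spots they take, listed in order of arrival, form such
-- a rearrangement.  Conversely, the first car takes the least free spot that
-- suits it, and exchanging that spot with the one assigned to the car leaves
-- the other cars dominated by the remaining free spots.  The same exchange,
-- applied to the sorted c and u, turns an arbitrary domination into cᵢ ≤ uᵢ.
module Submission where

open import Defs
open import Data.Empty using (⊥-elim)
open import Data.Fin using (zero; suc)
open import Data.List using (List; []; _∷_; _ʳ++_; length; filter)
import Data.List.Extrema.Nat as Extrema
open import Data.List.Membership.Propositional using (_∈_; _∉_)
open import Data.List.Membership.Propositional.Properties
  using (∈-∃++; ∈-filter⁺; ∈-filter⁻)
open import Data.List.Relation.Binary.Permutation.Propositional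
  using (_↭_; prep; swap; ↭-refl; ↭-sym; ↭-trans; ↭-reflexive; ↭⇒↭ₛ)
open import Data.List.Relation.Binary.Permutation.Propositional.Properties
  using (∈-resp-↭; All-resp-↭; shift; drop-∷; ↭-length)
open import Data.List.Relation.Binary.Pointwise using (Pointwise; []; _∷_)
open import Data.List.Relation.Unary.All as ListAll using ([]; _∷_)
open import Data.List.Relation.Unary.AllPairs as AllPairs using (AllPairs; []; _∷_)
open import Data.List.Relation.Unary.Any using (here; there)
open import Data.List.Relation.Unary.Any.Properties using (reverse⁺; reverse⁻)
open import Data.List.Relation.Unary.Linked as ListLinked using ([]; [-]; _∷_)
open import Data.List.Relation.Unary.Linked.Properties using (Linked⇒AllPairs)
open import Data.List.Relation.Unary.Unique.Propositional using (Unique)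
open import Data.Nat using (ℕ; zero; suc; _+_; _≤_; _<_; z≤n; _∸_; _≤?_)
open import Data.Nat.Properties
open import Data.List.Membership.DecPropositional _≟_ using (_∈?_)
open import Data.List.Sort ≤-decTotalOrder using (sort; sort-↭; sort-↗)
open import Data.Product using (_×_; _,_; ∃-syntax; proj₁; proj₂)
open import Data.Sum using (inj₁; inj₂)
open import Data.Vec as Vec using (Vec; []; _∷_; toList; lookup)
open import Data.Vec.Membership.Propositional.Properties using (∈-toList⁺; ∈-toList⁻)
open import Data.Vec.Properties using (length-toList; toList∘fromList)
open import Data.Vec.Relation.Unary.All as VecAll using (All; []; _∷_)
import Data.Vec.Relation.Unary.All.Properties as VecAll
open import Data.Vec.Relation.Unary.Linked as VecLinked using ([]; [-]; _∷_)
open import Function using (_∘_)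
open import Function.Bundles using (_⇔_; Equivalence; mk⇔)
open import Level using (Level)
open import Relation.Binary using (Rel)
open import Relation.Binary.PropositionalEquality
  using (_≡_; _≢_; refl; sym; trans; cong; subst; setoid)
open import Data.List.Relation.Binary.Permutation.Setoid.Properties (setoid ℕ)
  using (Unique-resp-↭)
open import Relation.Nullary using (yes; no)
open import Relation.Unary using (Pred; _≐_)

private
  variable
    a p ℓ : Level
    A : Set a
    k m n : ℕ

-- Transfer between vectors and lists, and along `cast`

toList-linked⁺ : {R : Rel A ℓ} {xs : Vec A k} →
                 VecLinked.Linked R xs → ListLinked.Linked R (toList xs)
toList-linked⁺ []                              = []
toList-linked⁺ [-]                             = [-]
toList-linked⁺ {xs = _ ∷ _ ∷ _} (Rxy ∷ linked) = Rxy ∷ toList-linked⁺ linked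

toList-linked⁻ : {R : Rel A ℓ} {xs : Vec A k} →
                 ListLinked.Linked R (toList xs) → VecLinked.Linked R xs
toList-linked⁻ {xs = []}        []             = []
toList-linked⁻ {xs = _ ∷ []}    [-]            = [-]
toList-linked⁻ {xs = _ ∷ _ ∷ _} (Rxy ∷ linked) = Rxy ∷ toList-linked⁻ linked

toList-pointwise⁺ : {R : Rel A ℓ} {xs ys : Vec A k} →
                    (∀ i → R (lookup xs i) (lookup ys i)) →
                    Pointwise R (toList xs) (toList ys)
toList-pointwise⁺ {xs = []}    {[]}    _ = []
toList-pointwise⁺ {xs = _ ∷ _} {_ ∷ _} R = R zero ∷ toList-pointwise⁺ (R ∘ suc)

toList-pointwise⁻ : {R : Rel A ℓ} {xs ys : Vec A k} →
                    Pointwise R (toList xs) (toList ys) →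
                    ∀ i → R (lookup xs i) (lookup ys i)
toList-pointwise⁻ {xs = _ ∷ _} {_ ∷ _} (Rxy ∷ _) zero    = Rxy
toList-pointwise⁻ {xs = _ ∷ _} {_ ∷ _} (_ ∷ Rs)  (suc i) = toList-pointwise⁻ Rs i

toList-surjective : (xs : List A) → length xs ≡ k → ∃[ v ] toList {n = k} v ≡ xs
toList-surjective xs refl = Vec.fromList xs , toList∘fromList xs

-- `cast` unfolds one entry at a time, so the induction is on the vector. `P` varies over all
-- predicates because each step moves the head into it.
cast⁺ : (P : ∀ {j} → Pred (Vec A j) p) .(eq : m ≡ n) {xs : Vec A m} →
        P xs → P (Vec.cast eq xs)
cast⁺ {m = zero}  {n = zero}  P eq {[]}     = λ pxs → pxs
cast⁺ {m = suc _} {n = suc _} P eq {x ∷ xs} = cast⁺ (λ ys → P (x ∷ ys)) (suc-injective eq)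

cast⁻ : (P : ∀ {j} → Pred (Vec A j) p) .(eq : m ≡ n) {xs : Vec A m} →
        P (Vec.cast eq xs) → P xs
cast⁻ {m = zero}  {n = zero}  P eq {[]}     = λ pxs → pxs
cast⁻ {m = suc _} {n = suc _} P eq {x ∷ xs} = cast⁻ (λ ys → P (x ∷ ys)) (suc-injective eq)

∈⇒↭∷ : ∀ {x} {xs : List A} → x ∈ xs → ∃[ ys ] xs ↭ x ∷ ys
∈⇒↭∷ x∈xs with ys , zs , refl ← ∈-∃++ x∈xs = _ , shift _ ys zs

-- Domination up to rearrangement

infix 4 _≼_

-- An assignment of spots to cars: `cs` keeps its order of arrival, and `vs` lists the spot reserved
-- for each car.
_≼_ : List ℕ → List ℕ → Set
cs ≼ us = ∃[ vs ] Pointwise _≤_ cs vs × vs ↭ us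

-- Each entry of `xs` takes its partner along, so `ys` undergoes the same permutation.
pointwise-↭ : {R : Rel A ℓ} {xs xs′ ys : List A} → xs ↭ xs′ → Pointwise R xs ys →
              ∃[ ys′ ] Pointwise R xs′ ys′ × ys′ ↭ ys
pointwise-↭ _↭_.refl       Rs             = _ , Rs , ↭-refl
pointwise-↭ (prep _ σ)     (Rxy ∷ Rs)     =
  let _ , Rs′ , τ = pointwise-↭ σ Rs in _ , Rxy ∷ Rs′ , prep _ τ
pointwise-↭ (swap _ _ σ)   (R₁ ∷ R₂ ∷ Rs) =
  let _ , Rs′ , τ = pointwise-↭ σ Rs in _ , R₂ ∷ R₁ ∷ Rs′ , swap _ _ τ
pointwise-↭ (_↭_.trans σ₁ σ₂) Rs          =
  let _ , Rs₁ , τ₁ = pointwise-↭ σ₁ Rs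
      _ , Rs₂ , τ₂ = pointwise-↭ σ₂ Rs₁
  in _ , Rs₂ , ↭-trans τ₂ τ₁

≼-respˡ-↭ : ∀ {cs ds us} → cs ↭ ds → cs ≼ us → ds ≼ us
≼-respˡ-↭ σ (_ , cs≤vs , τ) =
  let _ , ds≤ws , υ = pointwise-↭ σ cs≤vs in _ , ds≤ws , ↭-trans υ τ

-- The car holding `s` gives it up for `v`; raising an entry on the right preserves domination.
replace-larger : ∀ {s v cs vs} → s ≤ v → s ∈ vs → Pointwise _≤_ cs vs →
                 ∃[ ws ] Pointwise _≤_ cs ws × s ∷ ws ↭ v ∷ vs
replace-larger s≤v (here refl)  (c≤s ∷ cs≤vs) =
  _ , ≤-trans c≤s s≤v ∷ cs≤vs , swap _ _ ↭-refl
replace-larger s≤v (there s∈vs) (c≤x ∷ cs≤vs) =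
  let _ , cs≤ws , σ = replace-larger s≤v s∈vs cs≤vs
  in _ , c≤x ∷ cs≤ws , ↭-trans (swap _ _ ↭-refl) (↭-trans (prep _ σ) (swap _ _ ↭-refl))

-- The first car was assigned `v` but takes `s`. Either the two coincide, or `s` was reserved for a
-- later car, which receives `v` in return.
exchange : ∀ {s v cs vs us} → s ≤ v → Pointwise _≤_ cs vs → v ∷ vs ↭ s ∷ us → cs ≼ us
exchange s≤v cs≤vs σ with ∈-resp-↭ (↭-sym σ) (here refl)
... | here refl  = _ , cs≤vs , drop-∷ σ
... | there s∈vs =
  let _ , cs≤ws , τ = replace-larger s≤v s∈vs cs≤vs
  in _ , cs≤ws , drop-∷ (↭-trans τ σ)

pointwise-lower-bound : ∀ {c cs vs} → ListAll.All (c ≤_) cs → Pointwise _≤_ cs vs →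
                        ListAll.All (c ≤_) vs
pointwise-lower-bound []           []             = []
pointwise-lower-bound (c≤d ∷ c≤ds) (d≤v ∷ ds≤vs) =
  ≤-trans c≤d d≤v ∷ pointwise-lower-bound c≤ds ds≤vs

-- The least entry of `cs` lies below every assigned spot, hence below `u`. As `u` is least among
-- the spots, `u ≤ v`, and `exchange` gives domination between the tails.
sorted-≼⇒pointwise : ∀ {cs us} → AllPairs _≤_ cs → AllPairs _≤_ us →
                     cs ≼ us → Pointwise _≤_ cs us
sorted-≼⇒pointwise {us = []} _ _ ([] , [] , _) = []
sorted-≼⇒pointwise {us = []} _ _ (_ ∷ _ , _ , σ) with () ← ↭-length σ
sorted-≼⇒pointwise {us = _ ∷ _} _ _ ([] , _ , σ) with () ← ↭-length σ
sorted-≼⇒pointwise {us = u ∷ us} (c≤cs ∷ cs↗) (u≤us ∷ us↗) (v ∷ vs , c≤v ∷ cs≤vs , σ) =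
  ListAll.lookup c≤v∷vs (∈-resp-↭ (↭-sym σ) (here refl)) ∷
  sorted-≼⇒pointwise cs↗ us↗ (exchange u≤v cs≤vs σ)
  where
  c≤v∷vs = c≤v ∷ pointwise-lower-bound c≤cs cs≤vs
  u≤v    = ListAll.lookup (≤-refl ∷ u≤us) (∈-resp-↭ σ (here refl))

-- The witness `b` is the sorted list of entries of `c`, read back as a vector of length `k`.
≼⇒sorted-pointwise : (c u : Vec ℕ k) → Increasing u → toList c ≼ toList u →
                     ∃[ b ] (toList b ↭ toList c × WeaklyIncreasing {k} b ×
                             (∀ i → lookup b i ≤ lookup u i))
≼⇒sorted-pointwise c u u↗ c≼u
  with b , b≡ ← toList-surjective (sort (toList c))
                  (trans (↭-length (sort-↭ (toList c))) (length-toList c)) =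
  b , b↭c , toList-linked⁻ b↗ ,
  toList-pointwise⁻ (sorted-≼⇒pointwise
    (Linked⇒AllPairs ≤-trans b↗)
    (AllPairs.map <⇒≤ (Linked⇒AllPairs <-trans (toList-linked⁺ u↗)))
    (≼-respˡ-↭ (↭-sym b↭c) c≼u))
  where
  b↭c : toList b ↭ toList c
  b↭c = ↭-trans (↭-reflexive b≡) (sort-↭ (toList c))
  b↗ : ListLinked.Linked _≤_ (toList b)
  b↗ = subst (ListLinked.Linked _≤_) (sym b≡) (sort-↗ (toList c))

-- Free spots and the parking process

record Free (n : ℕ) (occ us : List ℕ) : Set where
  field
    unique  : Unique us
    members : ∀ i → i ∈ us ⇔ (i ∈[ n ] × i ∉ occ)

  free⇒spot : ∀ {i} → i ∈ us → i ∈[ n ]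
  free⇒spot = proj₁ ∘ Equivalence.to (members _)

  free⇒available : ∀ {i} → i ∈ us → i ∉ occ
  free⇒available = proj₂ ∘ Equivalence.to (members _)

  available⇒free : ∀ {i} → i ∈[ n ] → i ∉ occ → i ∈ us
  available⇒free i∈[n] i∉occ = Equivalence.from (members _) (i∈[n] , i∉occ)

open Free

-- Free spots matter only up to order, so any of them can be brought to the front and removed.
-- Uniqueness ensures that `s` does not remain in `us′`.
occupy : ∀ {occ us s us′} → Free n occ us → us ↭ s ∷ us′ → Free n (s ∷ occ) us′
occupy {n} {occ} {us} {s} {us′} F σ with Unique-resp-↭ (↭⇒↭ₛ σ) (unique F)
... | s≢us′ ∷ us′! = record { unique = us′! ; members = λ i → mk⇔ to from }
  where
  to : ∀ {i} → i ∈ us′ → i ∈[ n ] × i ∉ s ∷ occ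
  to i∈us′ = free⇒spot F i∈us , λ where
      (here refl)   → ListAll.lookup s≢us′ i∈us′ refl
      (there i∈occ) → free⇒available F i∈us i∈occ
    where i∈us = ∈-resp-↭ (↭-sym σ) (there i∈us′)
  from : ∀ {i} → i ∈[ n ] × i ∉ s ∷ occ → i ∈ us′
  from (i∈[n] , i∉) with ∈-resp-↭ σ (available⇒free F i∈[n] (i∉ ∘ there))
  ... | here refl   = ⊥-elim (i∉ (here refl))
  ... | there i∈us′ = i∈us′

least-above : ∀ {a v us} → v ∈ us → a ≤ v →
              ∃[ s ] s ∈ us × a ≤ s × (∀ {j} → j ∈ us → a ≤ j → s ≤ j)
least-above {a} {v} {us} v∈us a≤v =
  s , proj₁ s-suits , proj₂ s-suits ,
  λ j∈us a≤j → ListAll.lookup (Extrema.min≤xs v suitable) (∈-filter⁺ (a ≤?_) j∈us a≤j)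
  where
  suitable = filter (a ≤?_) us
  -- The default value `v` is itself free and at least `a`, so the minimum is suitable whether or
  -- not it is the default.
  s = Extrema.min v suitable
  s-suits : s ∈ us × a ≤ s
  s-suits = Extrema.argmin-all (λ x → x) {P = λ x → x ∈ us × a ≤ x}
              (v∈us , a≤v) (ListAll.tabulate (∈-filter⁻ (a ≤?_)))

parksIn-least : ∀ {occ us a s} → Free n occ us → s ∈ us → a ≤ s →
                (∀ {j} → j ∈ us → a ≤ j → s ≤ j) → ParksIn n occ a s
parksIn-least {occ = occ} F s∈us a≤s least = record
  { spot      = free⇒spot F s∈us
  ; reachable = a≤s
  ; available = free⇒available F s∈us
  ; first     = first
  }
  where
  first : ∀ j → j ∈[ _ ] → _ ≤ j → j < _ → j ∈ occ
  first j j∈[n] a≤j j<s with j ∈? occ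
  ... | yes j∈occ = j∈occ
  ... | no  j∉occ = ⊥-elim (<⇒≱ j<s (least (available⇒free F j∈[n] j∉occ) a≤j))

-- With as many cars as free spots, no spot is left at the end, so the spots taken exhaust `us`.
allPark⇒≼ : ∀ {occ us} {c : Vec ℕ k} → Free n occ us → length us ≡ k →
            AllPark n occ c → toList c ≼ us
allPark⇒≼ {us = []} F _   done                = [] , [] , ↭-refl
allPark⇒≼           F len (park s parks rest)
  with us′ , σ ← ∈⇒↭∷ (available⇒free F (ParksIn.spot parks) (ParksIn.available parks))
  with vs , c≤vs , τ ← allPark⇒≼ (occupy F σ)
                         (suc-injective (trans (sym (↭-length σ)) len)) rest =
  s ∷ vs , ParksIn.reachable parks ∷ c≤vs , ↭-trans (prep s τ) (↭-sym σ)

≼⇒allPark : ∀ {occ us} {c : Vec ℕ k} → Free n occ us → toList c ≼ us → AllPark n occ c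
≼⇒allPark {c = []}    F _ = done
≼⇒allPark {c = a ∷ c} F (v ∷ vs , a≤v ∷ c≤vs , σ)
  with v∈us ← ∈-resp-↭ σ (here refl)
  -- The reserved spot `v` shows that some free spot suits the car. The least such spot `s`
  -- satisfies `s ≤ v`, as `exchange` requires.
  with s , s∈us , a≤s , least ← least-above v∈us a≤v
  with us′ , τ ← ∈⇒↭∷ s∈us =
  park s (parksIn-least F s∈us a≤s least)
    (≼⇒allPark (occupy F τ) (exchange (least v∈us a≤v) c≤vs (↭-trans σ τ)))

-- The cars that represent the taken spots

available-parksIn : ∀ {occ a} → a ∈[ n ] → a ∉ occ → ParksIn n occ a a
available-parksIn a∈[n] a∉occ = record
  { spot      = a∈[n]
  ; reachable = ≤-refl
  ; available = a∉occ
  ; first     = λ _ _ a≤j j<a → ⊥-elim (<⇒≱ j<a a≤j)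
  }

parksIn-available : ∀ {occ a s} → a ∈[ n ] → a ∉ occ → ParksIn n occ a s → s ≡ a
parksIn-available a∈[n] a∉occ parks with m≤n⇒m<n∨m≡n (ParksIn.reachable parks)
-- Passing over `a` would mean that `a` was already taken.
... | inj₁ a<s = ⊥-elim (a∉occ (ParksIn.first parks _ a∈[n] ≤-refl a<s))
... | inj₂ a≡s = sym a≡s

∉-∷ : ∀ {x : A} {xs occ} → ListAll.All (x ≢_) xs → ListAll.All (_∉ occ) xs →
      ListAll.All (_∉ x ∷ occ) xs
∉-∷ x≢xs xs∉ = ListAll.zipWith
  (λ { (x≢y , y∉) (here refl) → x≢y refl ; (x≢y , y∉) (there y∈) → y∉ y∈ }) (x≢xs , xs∉)

-- Since the entries of `t` are distinct, each is still available when its car arrives, and the car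
-- parks there. Spots are pushed onto the front of `occ`, hence the reversal in `ʳ++`.
allPark-++⁻ : ∀ {occ} {t : Vec ℕ m} {c : Vec ℕ k} → All (_∈[ n ]) t → Unique (toList t) →
              ListAll.All (_∉ occ) (toList t) →
              AllPark n occ (t Vec.++ c) → AllPark n (toList t ʳ++ occ) c
allPark-++⁻ []        []         []        parked                = parked
allPark-++⁻ (t∈ ∷ ts) (t≢ ∷ ts!) (t∉ ∷ ts∉) (park s parks rest)
  with refl ← parksIn-available t∈ t∉ parks = allPark-++⁻ ts ts! (∉-∷ t≢ ts∉) rest

allPark-++⁺ : ∀ {occ} {t : Vec ℕ m} {c : Vec ℕ k} → All (_∈[ n ]) t → Unique (toList t) →
              ListAll.All (_∉ occ) (toList t) →
              AllPark n (toList t ʳ++ occ) c → AllPark n occ (t Vec.++ c)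
allPark-++⁺ []        []         []         parked = parked
allPark-++⁺ (t∈ ∷ ts) (t≢ ∷ ts!) (t∉ ∷ ts∉) parked =
  park _ (available-parksIn t∈ t∉) (allPark-++⁺ ts ts! (∉-∷ t≢ ts∉) parked)

increasing⇒unique : {v : Vec ℕ k} → Increasing v → Unique (toList v)
increasing⇒unique = AllPairs.map <⇒≢ ∘ Linked⇒AllPairs <-trans ∘ toList-linked⁺

-- `toList t ʳ++ []` unfolds to `reverse (toList t)`, so membership transfers through `reverse⁺` and
-- `reverse⁻`.
complement⇒free : {t : Vec ℕ m} {u : Vec ℕ k} → IsComplement n t u →
                  Free n (toList t ʳ++ []) (toList u)
complement⇒free C = record
  { unique  = increasing⇒unique (IsComplement.increasing C)
  ; members = λ i → let open Equivalence (IsComplement.members C i) in mk⇔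
      (λ i∈u → let i∈[n] , i∉t = to (∈-toList⁻ i∈u)
               in i∈[n] , i∉t ∘ ∈-toList⁻ ∘ reverse⁻)
      (λ (i∈[n] , i∉t) → ∈-toList⁺ (from (i∈[n] , i∉t ∘ reverse⁺ ∘ ∈-toList⁺)))
  }

-- Partial sums of gaps, and the equality of the two sets

partialSum-gapsFrom : ∀ {p} {u : Vec ℕ k} → VecLinked.Linked _≤_ (p ∷ u) →
                      ∀ i → p + partialSum (gapsFrom p u) i ≡ lookup u i
partialSum-gapsFrom {u = v ∷ u} (p≤v ∷ _) zero = m+[n∸m]≡n p≤v
partialSum-gapsFrom {p = p} {u = v ∷ u} (p≤v ∷ u↗) (suc i) =
  -- The sum telescopes: `p ≤ v` makes the truncated subtraction exact, so `p + (v ∸ p)` becomes the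
  -- new starting point `v`.
  trans (sym (+-assoc p (v ∸ p) _))
    (trans (cong (_+ partialSum (gapsFrom v u) i) (m+[n∸m]≡n p≤v))
      (partialSum-gapsFrom u↗ i))

partialSum-gaps : {u : Vec ℕ k} → Increasing u → ∀ i → partialSum (gaps u) i ≡ lookup u i
partialSum-gaps {u = _ ∷ _} u↗ = partialSum-gapsFrom (z≤n ∷ VecLinked.map <⇒≤ u↗)

pointwise-≤⇒All-≤ : ∀ {cs vs} → ListAll.All (_≤ n) vs → Pointwise _≤_ cs vs →
                    ListAll.All (_≤ n) cs
pointwise-≤⇒All-≤ []           []            = []
pointwise-≤⇒All-≤ (v≤n ∷ vs≤n) (c≤v ∷ cs≤vs) = ≤-trans c≤v v≤n ∷ pointwise-≤⇒All-≤ vs≤n cs≤vs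

theorem2p7 : ∀ (n m : ℕ) → 1 ≤ n → (m≤n : m ≤ n) →
    (t : Vec ℕ m) → All (_∈[ n ]) t → Increasing t →
    (u : Vec ℕ (n ∸ m)) (isU : IsComplement n t u) →
    PC n m≤n t ≐ PF (gaps u) (gaps-positive isU)
theorem2p7 n m _ m≤n t t∈ t↗ u isU = PC⇒PF , PF⇒PC
  where
  u↗ = IsComplement.increasing isU
  F  = complement⇒free isU
  t! = increasing⇒unique t↗

  t∉[] : ListAll.All (_∉ []) (toList t)
  t∉[] = ListAll.universal (λ _ ()) _

  PC⇒PF : ∀ {c} → PC n m≤n t c → PF (gaps u) (gaps-positive isU) c
  PC⇒PF {c} (c∈ , _ , parked) =
    let b , b↭c , b↗ , b≤u = ≼⇒sorted-pointwise c u u↗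
          (allPark⇒≼ F (length-toList u)
            (allPark-++⁻ t∈ t! t∉[] (cast⁻ (AllPark n []) (m+[n∸m]≡n m≤n) parked)))
    in VecAll.map proj₁ c∈ , b , b↭c , b↗ ,
       λ i → ≤-trans (b≤u i) (≤-reflexive (sym (partialSum-gaps u↗ i)))

  PF⇒PC : ∀ {c} → PF (gaps u) (gaps-positive isU) c → PC n m≤n t c
  PF⇒PC {c} (c>0 , b , b↭c , _ , b≤x) = c∈ ,
    cast⁺ All[n] (m+[n∸m]≡n m≤n) (VecAll.++⁺ t∈ c∈) ,
    cast⁺ (AllPark n []) (m+[n∸m]≡n m≤n) (allPark-++⁺ t∈ t! t∉[] (≼⇒allPark F c≼u))
    where
    All[n] : ∀ {j} → Pred (Vec ℕ j) _
    All[n] = All (_∈[ n ])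
    c≼u : toList c ≼ toList u
    -- The sorted `b` lies below `u` entry by entry, with `u` in its own order; the rearrangement
    -- from `b` to `c` then permutes the spots.
    c≼u = ≼-respˡ-↭ b↭c
      (_ , toList-pointwise⁺ (λ i → ≤-trans (b≤x i) (≤-reflexive (partialSum-gaps u↗ i))) , ↭-refl)
    c∈ : All (_∈[ n ]) c
    -- Membership in `PF` supplies the lower bound 1; the upper bound `n` comes from domination by
    -- spots of the street.
    c∈ = let _ , c≤v , σ = c≼u in VecAll.zip
      (c>0 , VecAll.toList⁻ (pointwise-≤⇒All-≤
        (All-resp-↭ (↭-sym σ) (ListAll.tabulate (proj₂ ∘ free⇒spot F))) c≤v))
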